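{- Let $k,r \in \mathbb{N}$ and $s \in [0, r]$. Then \[\mathsf{D}_k(C_{2}^{r}) \le \mathsf{D}_{\mathsf{D}_{k}(C_2^s) - s} (C_2^{r-s}) + s.\]
   Context: $C_2^m$ is the elementary abelian $2$-group of rank $m$ ($C_2^0$ is the trivial group). A sequence over a finite abelian group $G$ is a finite unordered list of elements with repetitions; zero-sum means its terms sum to $0$. $\mathsf{D}_k(G)$ ($k\in\mathbb{N}$) is the smallest $\ell$ such that every sequence over $G$ of length at least $\ell$ has $k$ disjoint non-empty zero-sum subsequences. -}

module Defs where

open import Algebra.Structures using (IsAbelianGroup)
open import Algebra.Bundles using (Group)
import Algebra.Properties.Group as GroupProperties
open import Data.Bool using (Bool; false; _xor_)
open import Data.Bool.Properties using (xor-assoc; xor-comm; xor-identityˡ; xor-identityʳ; xor-same)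
open import Data.Fin as Fin using (Fin)
import Data.Fin.Properties as Fin
open import Data.List using (List; []; _∷_; _++_; concat; foldr; length; take; drop)
open import Data.List.Membership.Propositional.Properties using (∈-∃++)
import Data.List.Membership.DecPropositional as DecMembership
open import Data.List.Properties using (++-assoc; take++drop≡id; length-take; length-drop; length-++; ≡-dec)
open import Data.List.Relation.Binary.Permutation.Propositional using (_↭_; ↭-refl; ↭-sym; ↭-trans; ↭-prep; ↭-reflexive)
open import Data.List.Relation.Binary.Permutation.Propositional.Properties using (shift; shifts; drop-mid; ++⁺ˡ; ++⁺ʳ; ↭-length; ↭-empty-inv; ∈-resp-↭)
open import Data.List.Relation.Unary.All as All using (All; []; _∷_)
open import Data.List.Relation.Unary.Any using (here)
open import Data.Nat using (ℕ; zero; suc; _+_; _*_; _∸_; _^_; _≤_; _<_; z≤n; s≤s)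
import Data.Nat as ℕ
open import Data.Nat.Properties using (≤-trans; ≤-reflexive; m≤m+n; m≤n+m; m≤n⇒m⊓n≡m; m+n∸m≡n; ∸-monoˡ-≤; ∸-monoʳ-≤; m∸n≤m; m+[n∸m]≡n; <⇒≤; m<n⇒0<n∸m; n<1+n; suc-injective; module ≤-Reasoning)
open import Data.Product using (∃; _×_; _,_; proj₁; proj₂)
open import Data.Product.Function.NonDependent.Propositional using (_×-↔_)
open import Data.Vec as Vec using (Vec; []; _∷_)
import Data.Vec.Properties as Vec
open import Function using (_∘_; id)
open import Function.Bundles using (_↔_; mk↔ₛ′; module Inverse)
open import Function.Construct.Composition using (_↔-∘_)
open import Function.Properties.Inverse using (↔-sym; ↔⇒↣)
open import Level using (0ℓ)
open import Relation.Binary.Definitions using (DecidableEquality)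
open import Relation.Binary.PropositionalEquality using (_≡_; _≢_; refl; sym; trans; cong; cong₂; subst; isEquivalence; module ≡-Reasoning)
open import Relation.Nullary using (Dec; yes; no; contradiction)
open import Relation.Nullary.Decidable using (map′; _×-dec_; _⊎-dec_; ¬?)
open import Relation.Unary using (Pred; Decidable)
open import Data.Sum using (_⊎_; inj₁; inj₂)

record FiniteAbelianGroup : Set₁ where
  infixl 7 _∙_
  infix 8 _⁻¹
  field
    Carrier        : Set
    _∙_            : Carrier → Carrier → Carrier
    ε              : Carrier
    _⁻¹            : Carrier → Carrier
    isAbelianGroup : IsAbelianGroup _≡_ _∙_ ε _⁻¹
    order          : ℕ
    enumeration    : Carrier ↔ Fin order

  open IsAbelianGroup isAbelianGroup public
    using (isGroup; assoc; comm; identityˡ; identityʳ; inverseˡ; inverseʳ)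

  _≟_ : DecidableEquality Carrier
  _≟_ = Fin.inj⇒≟ (↔⇒↣ enumeration)

Vec-Bool↔Fin : ∀ m → Vec Bool m ↔ Fin (2 ^ m)
Vec-Bool↔Fin zero    = mk↔ₛ′ (λ _ → Fin.zero) (λ _ → []) (λ { Fin.zero → refl ; (Fin.suc ()) }) (λ { [] → refl })
Vec-Bool↔Fin (suc m) = ↔-sym Fin.*↔× ↔-∘ ((↔-sym Fin.2↔Bool ×-↔ Vec-Bool↔Fin m) ↔-∘ uncons)
  where
  uncons : Vec Bool (suc m) ↔ (Bool × Vec Bool m)
  uncons = mk↔ₛ′ (λ { (x ∷ xs) → x , xs }) (λ (x , xs) → x ∷ xs) (λ _ → refl) (λ { (_ ∷ _) → refl })

-- C₂ is Bool with exclusive or; in particular every element is its own inverse.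
C₂^_ : ℕ → FiniteAbelianGroup
C₂^ m = record
  { Carrier        = Vec Bool m
  ; _∙_            = Vec.zipWith _xor_
  ; ε              = Vec.replicate m false
  ; _⁻¹            = Vec.map id
  ; isAbelianGroup = record
    { isGroup = record
      { isMonoid = record
        { isSemigroup = record
          { isMagma = record { isEquivalence = isEquivalence ; ∙-cong = cong₂ _ }
          ; assoc   = Vec.zipWith-assoc xor-assoc
          }
        ; identity = Vec.zipWith-identityˡ xor-identityˡ , Vec.zipWith-identityʳ xor-identityʳ
        }
      ; inverse = Vec.zipWith-inverseˡ xor-same , Vec.zipWith-inverseʳ xor-same
      ; ⁻¹-cong = cong _
      }
    ; comm = Vec.zipWith-comm xor-comm
    }
  ; order          = 2 ^ m
  ; enumeration    = Vec-Bool↔Fin m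
  }

infix 9 C₂^_

module _ (G : FiniteAbelianGroup) where
  open FiniteAbelianGroup G

  -- A sequence (unordered, with repetitions) is represented by any list of its
  -- terms; everything below is invariant under permuting that list.
  Sequence : Set
  Sequence = List Carrier

  σ : Sequence → Carrier
  σ = foldr _∙_ ε

  NonEmptyZeroSum : Pred Sequence 0ℓ
  NonEmptyZeroSum T = T ≢ [] × σ T ≡ ε

  -- T₁, …, T_k are disjoint subsequences of S when, as multisets,
  -- S is their union together with some remaining terms R.
  HasDisjointZeroSums : ℕ → Pred Sequence 0ℓ
  HasDisjointZeroSums k S =
    ∃ λ (Ts : List Sequence) → length Ts ≡ k × All NonEmptyZeroSum Ts ×
      ∃ λ (R : Sequence) → S ↭ concat Ts ++ R

  Forces : ℕ → Pred ℕ 0ℓ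
  Forces k ℓ = ∀ (S : Sequence) → ℓ ≤ length S → HasDisjointZeroSums k S

IsLeast : Pred ℕ 0ℓ → Pred ℕ 0ℓ
IsLeast P ℓ = P ℓ × (∀ j → P j → ℓ ≤ j)

-- The remainder shows that the least ℓ with Forces G k ℓ exists: the property
-- is decidable, and it holds for ℓ = k * order.

least : ∀ {P : Pred ℕ 0ℓ} → Decidable P → ∀ n → P n → ∃ (IsLeast P)
least P? zero    p = 0 , p , λ _ _ → z≤n
least P? (suc n) p with P? 0
... | yes p₀ = 0 , p₀ , λ _ _ → z≤n
... | no ¬p₀ with m , pm , min ← least (P? ∘ suc) n p =
  suc m , pm , λ { zero p₀ → contradiction p₀ ¬p₀ ; (suc j) pj → s≤s (min j pj) }

Searchable : Set → Set₁
Searchable A = ∀ {P : Pred A 0ℓ} → Decidable P → Dec (∃ P)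

module _ {A : Set} (any? : Searchable A) where

  anyList≤? : ∀ n {P : Pred (List A) 0ℓ} → Decidable P → Dec (∃ λ xs → length xs ≤ n × P xs)
  anyList≤? zero    P? = map′ (λ p → [] , z≤n , p) (λ { ([] , _ , p) → p }) (P? [])
  anyList≤? (suc n) P? = map′
    (λ { (inj₁ p) → [] , z≤n , p ; (inj₂ (x , xs , le , p)) → x ∷ xs , s≤s le , p })
    (λ { ([] , _ , p) → inj₁ p ; (x ∷ xs , s≤s le , p) → inj₂ (x , xs , le , p) })
    (P? [] ⊎-dec any? (λ x → anyList≤? n (P? ∘ (x ∷_))))

  allList≡? : ∀ n {P : Pred (List A) 0ℓ} → Decidable P → Dec (∀ xs → length xs ≡ n → P xs)
  allList≡? n {P} P? with anyList≤? n (λ xs → (length xs ℕ.≟ n) ×-dec ¬? (P? xs))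
  ... | yes (xs , _ , eq , ¬p) = no λ all → ¬p (all xs eq)
  ... | no none = yes λ xs eq → stable xs eq (P? xs)
    where
    stable : ∀ xs → length xs ≡ n → Dec (P xs) → P xs
    stable xs eq (yes p) = p
    stable xs eq (no ¬p) = contradiction (xs , ≤-reflexive eq , eq , ¬p) none

-- Lists of lists whose entries all have length at most b.
anyLists? : ∀ {A : Set} → Searchable A → ∀ b k {P : Pred (List (List A)) 0ℓ} → Decidable P →
            Dec (∃ λ xss → length xss ≡ k × All (λ xs → length xs ≤ b) xss × P xss)
anyLists? any? b zero    P? = map′ (λ p → [] , refl , [] , p) (λ { ([] , _ , _ , p) → p }) (P? [])
anyLists? any? b (suc k) P? = map′
  (λ { (x , le , xss , eq , les , p) → x ∷ xss , cong suc eq , le ∷ les , p })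
  (λ { (x ∷ xss , eq , le ∷ les , p) → x , le , xss , suc-injective eq , les , p })
  (anyList≤? any? b (λ x → anyLists? any? b k (P? ∘ (x ∷_))))

module _ {A : Set} (_≟_ : DecidableEquality A) where
  open DecMembership _≟_ using (_∈?_)

  _↭?_ : ∀ (xs ys : List A) → Dec (xs ↭ ys)
  []       ↭? []       = yes ↭-refl
  []       ↭? (y ∷ ys) = no λ p → contradiction (↭-empty-inv (↭-sym p)) λ ()
  (x ∷ xs) ↭? ys with x ∈? ys
  ... | no x∉ys = no λ p → x∉ys (∈-resp-↭ p (here refl))
  ... | yes x∈ys with as , bs , refl ← ∈-∃++ x∈ys =
    map′ (λ p → ↭-trans (↭-prep x p) (↭-sym (shift x as bs))) (drop-mid [] as) (xs ↭? (as ++ bs))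

concat-bounds : ∀ {A : Set} (xss : List (List A)) {b} → length (concat xss) ≤ b → All (λ xs → length xs ≤ b) xss
concat-bounds []         le = []
concat-bounds (xs ∷ xss) le rewrite length-++ xs {concat xss} =
  ≤-trans (m≤m+n _ _) le ∷ concat-bounds xss (≤-trans (m≤n+m _ (length xs)) le)

module _ (G : FiniteAbelianGroup) where
  open FiniteAbelianGroup G
  open Inverse enumeration using (to; from; strictlyInverseʳ)

  anyElement? : Searchable Carrier
  anyElement? {P} P? = map′ (λ (i , p) → from i , p) (λ (x , p) → to x , subst P (sym (strictlyInverseʳ x)) p)
    (Fin.any? (P? ∘ from))

  nonEmptyZeroSum? : Decidable (NonEmptyZeroSum G)
  nonEmptyZeroSum? T = ¬? (≡-dec _≟_ T []) ×-dec (σ G T ≟ ε)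

  hasDisjointZeroSums? : ∀ k → Decidable (HasDisjointZeroSums G k)
  hasDisjointZeroSums? k S = map′
    (λ { (Ts , eq , _ , zs , R , _ , p) → Ts , eq , zs , R , p })
    (λ { (Ts , eq , zs , R , p) →
      let len : length S ≡ length (concat Ts) + length R
          len = trans (↭-length p) (length-++ (concat Ts))
      in Ts , eq , concat-bounds Ts (≤-trans (m≤m+n _ _) (≤-reflexive (sym len))) , zs , R ,
         ≤-trans (m≤n+m _ (length (concat Ts))) (≤-reflexive (sym len)) , p })
    (anyLists? anyElement? (length S) k (λ Ts →
      All.all? nonEmptyZeroSum? Ts ×-dec
      anyList≤? anyElement? (length S) (λ R → _↭?_ _≟_ S (concat Ts ++ R))))

  extend : ∀ k S U → HasDisjointZeroSums G k S → HasDisjointZeroSums G k (S ++ U)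
  extend k S U (Ts , eq , zs , R , p) =
    Ts , eq , zs , R ++ U , ↭-trans (++⁺ʳ U p) (↭-reflexive (++-assoc (concat Ts) R U))

  forces? : ∀ k → Decidable (Forces G k)
  forces? k ℓ = map′
    (λ h S le → subst (HasDisjointZeroSums G k) (take++drop≡id ℓ S)
      (extend k (take ℓ S) (drop ℓ S) (h (take ℓ S) (trans (length-take ℓ S) (m≤n⇒m⊓n≡m le)))))
    (λ h S eq → h S (≤-reflexive (sym eq)))
    (allList≡? anyElement? ℓ (hasDisjointZeroSums? k))

  σ-++ : ∀ S T → σ G (S ++ T) ≡ σ G S ∙ σ G T
  σ-++ []      T = sym (identityˡ _)
  σ-++ (x ∷ S) T = trans (cong (x ∙_) (σ-++ S T)) (sym (assoc x _ _))

  -- Two of the order + 1 initial segments have equal sums; the block between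
  -- them is a non-empty zero-sum subsequence.
  zeroSumBlock : ∀ S → order ≤ length S →
    ∃ λ A → ∃ λ T → ∃ λ B → S ≡ A ++ T ++ B × length T ≤ order × NonEmptyZeroSum G T
  zeroSumBlock S le with i , j , i<j , eq ← Fin.pigeonhole (n<1+n order) (λ i → to (σ G (take (Fin.toℕ i) S))) =
    A , T , B , S≡ , T≤ , T≢[] , σT
    where
    m d : ℕ
    m = Fin.toℕ i
    d = Fin.toℕ j ∸ m
    A T B : Sequence G
    A = take m S
    T = take d (drop m S)
    B = drop d (drop m S)

    j≤ : Fin.toℕ j ≤ order
    j≤ = Fin.toℕ≤pred[n] j

    S≡ : S ≡ A ++ T ++ B
    S≡ = sym (trans (cong (A ++_) (take++drop≡id d (drop m S))) (take++drop≡id m S))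

    lenT : length T ≡ d
    lenT = trans (length-take d (drop m S)) (m≤n⇒m⊓n≡m
      (≤-trans (∸-monoˡ-≤ m (≤-trans j≤ le)) (≤-reflexive (sym (length-drop m S)))))

    T≤ : length T ≤ order
    T≤ = ≤-trans (≤-reflexive lenT) (≤-trans (m∸n≤m (Fin.toℕ j) m) j≤)

    T≢[] : T ≢ []
    T≢[] T≡[] = contradiction (subst (0 <_) (trans (sym lenT) (cong length T≡[])) (m<n⇒0<n∸m i<j)) λ ()

    take-+ : ∀ a b (xs : Sequence G) → take (a + b) xs ≡ take a xs ++ take b (drop a xs)
    take-+ zero    b xs       = refl
    take-+ (suc a) zero    [] = refl
    take-+ (suc a) (suc b) [] = refl
    take-+ (suc a) b (x ∷ xs) = cong (x ∷_) (take-+ a b xs)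

    σA : σ G A ≡ σ G (take (Fin.toℕ j) S)
    σA = trans (sym (strictlyInverseʳ _)) (trans (cong from eq) (strictlyInverseʳ _))

    σT : σ G T ≡ ε
    σT = GroupProperties.∙-cancelˡ group (σ G A) (σ G T) ε (begin
      σ G A ∙ σ G T           ≡⟨ σ-++ A T ⟨
      σ G (A ++ T)            ≡⟨ cong (σ G) (take-+ m d S) ⟨
      σ G (take (m + d) S)    ≡⟨ cong (λ n → σ G (take n S)) (m+[n∸m]≡n (<⇒≤ i<j)) ⟩
      σ G (take (Fin.toℕ j) S) ≡⟨ σA ⟨
      σ G A                   ≡⟨ identityʳ _ ⟨
      σ G A ∙ ε               ∎)
      where
      open ≡-Reasoning
      group : Group 0ℓ 0ℓ
      group = record { isGroup = isGroup }

  rest : ∀ k (A T B : Sequence G) → order + k * order ≤ length (A ++ T ++ B) → length T ≤ order →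
         k * order ≤ length (A ++ B)
  rest k A T B le T≤ = begin
    k * order                                  ≡⟨ m+n∸m≡n order _ ⟨
    order + k * order ∸ order                  ≤⟨ ∸-monoˡ-≤ order le ⟩
    length (A ++ T ++ B) ∸ order               ≤⟨ ∸-monoʳ-≤ (length (A ++ T ++ B)) T≤ ⟩
    length (A ++ T ++ B) ∸ length T            ≡⟨ cong (_∸ length T) (trans (↭-length (shifts A T)) (length-++ T)) ⟩
    length T + length (A ++ B) ∸ length T      ≡⟨ m+n∸m≡n (length T) _ ⟩
    length (A ++ B)                            ∎
    where open ≤-Reasoning

  forces-k*order : ∀ k → Forces G k (k * order)
  forces-k*order zero    S le = [] , refl , [] , S , ↭-refl
  forces-k*order (suc k) S le
    with A , T , B , refl , T≤ , zT ← zeroSumBlock S (≤-trans (m≤m+n order (k * order)) le)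
    with Ts , eq , zs , R , p ← forces-k*order k (A ++ B) (rest k A T B le T≤)
    = T ∷ Ts , cong suc eq , zT ∷ zs , R ,
      ↭-trans (shifts A T) (↭-trans (++⁺ˡ T p) (↭-reflexive (sym (++-assoc T (concat Ts) R))))

D-exists : ∀ k G → ∃ (IsLeast (Forces G k))
D-exists k G = least (forces? G k) (k * FiniteAbelianGroup.order G) (forces-k*order G k)

-- For k ≥ 1 one has s < D k (C₂^ s), because a basis of C₂^ s has no non-empty
-- zero-sum subsequence; so D k (C₂^ s) ∸ s is a true, positive difference.
D : ℕ → FiniteAbelianGroup → ℕ
D k G = proj₁ (D-exists k G)

D-isLeast : ∀ k G → IsLeast (Forces G k) (D k G)
D-isLeast k G = proj₂ (D-exists k G)

{-# OPTIONS --safe #-}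

-- Let S be a sequence over C₂^r of length at least D_m(C₂^(r-s)) + s, where
-- m = D_k(C₂^s) - s. Any s terms E of S lie in a subgroup H ≅ C₂^s with
-- quotient C₂^(r-s). The remaining terms contain m disjoint non-empty
-- subsequences whose sums lie in H. Together with the s terms of E these sums
-- form a sequence of length D_k(C₂^s) over H, and its k disjoint zero-sum
-- subsequences unfold to disjoint zero-sum subsequences of S.
module Submission where

open import Defs
open import Data.Nat using (ℕ; zero; suc; _+_; _∸_; _≤_; s≤s)
open import Algebra.Bundles using (module CommutativeRing)
import Algebra.Properties.CommutativeSemigroup as CommutativeSemigroupProperties
open import Data.Bool using (Bool; true; false; _xor_; _∧_)
open import Data.Bool.Properties using (∧-distribʳ-xor; xor-∧-commutativeRing)
open import Data.List using (List; []; _∷_; [_]; _++_; concat; length; map; take; drop)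
open import Data.List.Properties using (++-assoc; ++-conicalˡ; concat-++; concat-concat; concat-map-[_]; length-++; length-drop; length-map; length-take; map-∘; take++drop≡id; ∷-injective)
open import Data.List.Relation.Binary.Permutation.Propositional using (_↭_; refl; prep; swap; trans; ↭-refl; ↭-trans; module PermutationReasoning)
open import Data.List.Relation.Binary.Permutation.Propositional.Properties using (All-resp-↭; shifts; ++⁺ˡ; ++⁺ʳ; ↭-map-inv)
open import Data.List.Relation.Unary.All as All using (All; []; _∷_)
import Data.List.Relation.Unary.All.Properties as All
open import Data.Nat.Properties using (m≤n⇒m⊓n≡m; m≤n+m; m≤n+m∸n; m+n∸n≡m; ∸-monoˡ-≤; ≤-trans; ≤-reflexive)
open import Data.Product using (∃; ∃₂; _×_; _,_; proj₁; proj₂)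
open import Data.Vec as Vec using (Vec; []; _∷_)
import Data.Vec.Properties as Vec
open import Function using (_∘_)
open import Relation.Binary.PropositionalEquality as ≡ using (_≡_; _≢_; refl; sym; cong; cong₂; subst; module ≡-Reasoning)

-- Pulling decompositions of an image sequence back along a map.

module _ {A B : Set} (f : A → B) where

  map-++⁻ : ∀ xs {ys zs} → map f xs ≡ ys ++ zs →
            ∃₂ λ us vs → xs ≡ us ++ vs × ys ≡ map f us × zs ≡ map f vs
  map-++⁻ xs       {[]}     eq = [] , xs , refl , refl , sym eq
  map-++⁻ (x ∷ xs) {y ∷ ys} eq
    with fx≡y , eq′ ← ∷-injective eq
    with us , vs , refl , refl , refl ← map-++⁻ xs {ys} eq′
    = x ∷ us , vs , refl , cong (_∷ _) (sym fx≡y) , refl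

  map-concat-++⁻ : ∀ xs yss {zs} → map f xs ≡ concat yss ++ zs →
                   ∃₂ λ uss vs → xs ≡ concat uss ++ vs × yss ≡ map (map f) uss
  map-concat-++⁻ xs []         eq = [] , xs , refl , refl
  map-concat-++⁻ xs (ys ∷ yss) {zs} eq
    with us , vs , refl , refl , eq′ ← map-++⁻ xs {ys} (≡.trans eq (++-assoc ys (concat yss) zs))
    with uss , ws , refl , refl ← map-concat-++⁻ vs yss (sym eq′)
    = us ∷ uss , ws , sym (++-assoc us (concat uss) ws) , refl

  -- Disjoint subsequences of an image sequence lift to disjoint subsequences upstairs, even if `f`
  -- is not injective: reordering `xs` as its image is reordered turns the splitting into one by
  -- position.
  map-↭-concat-++⁻ : ∀ xs yss {zs} → map f xs ↭ concat yss ++ zs →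
                     ∃₂ λ uss vs → xs ↭ concat uss ++ vs × yss ≡ map (map f) uss
  map-↭-concat-++⁻ xs yss p
    with xs′ , eq , q ← ↭-map-inv f p
    with uss , vs , refl , refl ← map-concat-++⁻ xs′ yss (sym eq)
    = uss , vs , q , refl

concat-↭ : ∀ {A : Set} {xss yss : List (List A)} → xss ↭ yss → concat xss ↭ concat yss
concat-↭ refl           = ↭-refl
concat-↭ (prep xs p)    = ++⁺ˡ xs (concat-↭ p)
concat-↭ (swap xs ys p) = ↭-trans (shifts xs ys) (++⁺ˡ ys (++⁺ˡ xs (concat-↭ p)))
concat-↭ (trans p q)    = ↭-trans (concat-↭ p) (concat-↭ q)

-- Homomorphisms and sums of sequences.

infix 4 _⟶_

record _⟶_ (G H : FiniteAbelianGroup) : Set where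
  private
    module G = FiniteAbelianGroup G
    module H = FiniteAbelianGroup H
  field
    ⟦_⟧    : G.Carrier → H.Carrier
    ε-homo : ⟦ G.ε ⟧ ≡ H.ε
    ∙-homo : ∀ x y → ⟦ x G.∙ y ⟧ ≡ ⟦ x ⟧ H.∙ ⟦ y ⟧

  σ-homo : ∀ S → ⟦ σ G S ⟧ ≡ σ H (map ⟦_⟧ S)
  σ-homo []      = ε-homo
  σ-homo (x ∷ S) = ≡.trans (∙-homo x (σ G S)) (cong (⟦ x ⟧ H.∙_) (σ-homo S))

open _⟶_ using (⟦_⟧; ε-homo; ∙-homo; σ-homo)

id⟶ : ∀ {G} → G ⟶ G
id⟶ = record { ⟦_⟧ = λ x → x ; ε-homo = refl ; ∙-homo = λ _ _ → refl }

_∘⟶_ : ∀ {G H K} → H ⟶ K → G ⟶ H → G ⟶ K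
g ∘⟶ f = record
  { ⟦_⟧    = ⟦ g ⟧ ∘ ⟦ f ⟧
  ; ε-homo = ≡.trans (cong ⟦ g ⟧ (ε-homo f)) (ε-homo g)
  ; ∙-homo = λ x y → ≡.trans (cong ⟦ g ⟧ (∙-homo f x y)) (∙-homo g (⟦ f ⟧ x) (⟦ f ⟧ y))
  }

σ-concat : ∀ G Ss → σ G (concat Ss) ≡ σ G (map (σ G) Ss)
σ-concat G []       = refl
σ-concat G (S ∷ Ss) = ≡.trans (σ-++ G S (concat Ss)) (cong (_ ∙_) (σ-concat G Ss))
  where open FiniteAbelianGroup G

σ-trivial : ∀ G {S} → All (_≡ FiniteAbelianGroup.ε G) S → σ G S ≡ FiniteAbelianGroup.ε G
σ-trivial G []           = refl
σ-trivial G (refl ∷ all) = ≡.trans (identityˡ _) (σ-trivial G all)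
  where open FiniteAbelianGroup G

-- An embedding of G into Q × K; in particular ψ embeds the kernel of π into K.
record Embedding (G Q K : FiniteAbelianGroup) : Set where
  field
    π      : G ⟶ Q
    ψ      : G ⟶ K
    kernel : ∀ x → ⟦ π ⟧ x ≡ FiniteAbelianGroup.ε Q → ⟦ ψ ⟧ x ≡ FiniteAbelianGroup.ε K →
             x ≡ FiniteAbelianGroup.ε G

-- Combining zero-sum subsequences over `Q` and `K` into ones over `G`.

module _ {G Q K : FiniteAbelianGroup} (embedding : Embedding G Q K) where
  open Embedding embedding
  private
    module Q = FiniteAbelianGroup Q

  -- The kernel of `π` is never formed as a group: its elements appear as sums of such blocks and
  -- are compared through `ψ`.
  KernelBlock : Sequence G → Set
  KernelBlock T = T ≢ [] × ⟦ π ⟧ (σ G T) ≡ Q.ε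

  kernelBlock-map⁻ : ∀ {T} → NonEmptyZeroSum Q (map ⟦ π ⟧ T) → KernelBlock T
  kernelBlock-map⁻ {T} (ne , zs) = (λ { refl → ne refl }) , ≡.trans (σ-homo π T) zs

  kernelBlock-[_] : ∀ {x} → ⟦ π ⟧ x ≡ Q.ε → KernelBlock [ x ]
  kernelBlock-[ eq ] = (λ ()) , ≡.trans (cong ⟦ π ⟧ (FiniteAbelianGroup.identityʳ G _)) eq

  -- The total sum is a sum of kernel elements, so `π` kills it; `ψ` kills it by the hypothesis over
  -- `K`. Hence `kernel` applies.
  concat-zeroSum : ∀ {U} → All KernelBlock U → NonEmptyZeroSum K (map (⟦ ψ ⟧ ∘ σ G) U) →
                   NonEmptyZeroSum G (concat U)
  concat-zeroSum {[]}    _ (ne , _) with () ← ne refl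
  concat-zeroSum {T ∷ U} all@((T≢[] , _) ∷ _) (_ , zs) =
    T≢[] ∘ ++-conicalˡ T (concat U) , kernel _ πσ ψσ
    where
    open ≡-Reasoning
    πσ : ⟦ π ⟧ (σ G (concat (T ∷ U))) ≡ Q.ε
    πσ = begin
      ⟦ π ⟧ (σ G (concat (T ∷ U)))            ≡⟨ cong ⟦ π ⟧ (σ-concat G (T ∷ U)) ⟩
      ⟦ π ⟧ (σ G (map (σ G) (T ∷ U)))         ≡⟨ σ-homo π (map (σ G) (T ∷ U)) ⟩
      σ Q (map ⟦ π ⟧ (map (σ G) (T ∷ U)))     ≡⟨ σ-trivial Q (All.map⁺ (All.map⁺ (All.map proj₂ all))) ⟩
      Q.ε                                     ∎
    ψσ : ⟦ ψ ⟧ (σ G (concat (T ∷ U))) ≡ FiniteAbelianGroup.ε K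
    ψσ = begin
      ⟦ ψ ⟧ (σ G (concat (T ∷ U)))            ≡⟨ cong ⟦ ψ ⟧ (σ-concat G (T ∷ U)) ⟩
      ⟦ ψ ⟧ (σ G (map (σ G) (T ∷ U)))         ≡⟨ σ-homo ψ (map (σ G) (T ∷ U)) ⟩
      σ K (map ⟦ ψ ⟧ (map (σ G) (T ∷ U)))     ≡⟨ cong (σ K) (map-∘ (T ∷ U)) ⟨
      σ K (map (⟦ ψ ⟧ ∘ σ G) (T ∷ U))         ≡⟨ zs ⟩
      FiniteAbelianGroup.ε K                  ∎

  -- Each block counts as one term over `K`, namely the image of its sum. A zero-sum subsequence
  -- there selects a family of blocks, which is then concatenated.
  merge-blocks : ∀ {k n} W → Forces K k n → n ≤ length W → All KernelBlock W →
                 HasDisjointZeroSums G k (concat W)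
  merge-blocks W forces n≤ all
    with Ts , refl , zs , R , p ← forces (map (⟦ ψ ⟧ ∘ σ G) W) (≤-trans n≤ (≤-reflexive (sym (length-map _ W))))
    with Us , V , q , refl ← map-↭-concat-++⁻ (⟦ ψ ⟧ ∘ σ G) W Ts p
    = map concat Us , ≡.trans (length-map concat Us) (sym (length-map _ Us)) ,
      All.map⁺ (All.zipWith (λ (all , z) → concat-zeroSum all z)
        (All.concat⁻ (All.++⁻ˡ (concat Us) (All-resp-↭ q all)) , All.map⁻ zs)) ,
      concat V , (begin
        concat W                               ↭⟨ concat-↭ q ⟩
        concat (concat Us ++ V)                ≡⟨ concat-++ (concat Us) V ⟨
        concat (concat Us) ++ concat V         ≡⟨ cong (_++ concat V) (concat-concat Us) ⟨
        concat (map concat Us) ++ concat V     ∎)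
    where open PermutationReasoning

  -- Every term of `E` is a block by itself, and `S` supplies `m` further blocks through `Q`;
  -- together they suffice for `merge-blocks`.
  hasDisjointZeroSums-++ : ∀ {k m ℓ n} E S → Forces Q m ℓ → Forces K k n → n ≤ length E + m →
    All (λ x → ⟦ π ⟧ x ≡ Q.ε) E → ℓ ≤ length S → HasDisjointZeroSums G k (E ++ S)
  hasDisjointZeroSums-++ {k} {n = n} E S forcesQ forcesK n≤ E⊆ker ℓ≤
    with Ts , refl , zs , R , p ← forcesQ (map ⟦ π ⟧ S) (≤-trans ℓ≤ (≤-reflexive (sym (length-map _ S))))
    with Us , V , q , refl ← map-↭-concat-++⁻ ⟦ π ⟧ S Ts p
    with Vs , eq , zs′ , R′ , p′ ← merge-blocks {k} {n} (map [_] E ++ Us) forcesK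
           (≤-trans n≤ (≤-reflexive (sym (≡.trans (length-++ (map [_] E)) (cong₂ _+_ (length-map _ E) (sym (length-map _ Us)))))))
           (All.++⁺ (All.map⁺ (All.map kernelBlock-[_] E⊆ker)) (All.map kernelBlock-map⁻ (All.map⁻ zs)))
    = Vs , eq , zs′ , R′ ++ V , (begin
        E ++ S                                     ↭⟨ ++⁺ˡ E q ⟩
        E ++ concat Us ++ V                        ≡⟨ ++-assoc E (concat Us) V ⟨
        (E ++ concat Us) ++ V                      ≡⟨ cong (λ F → (F ++ concat Us) ++ V) (concat-map-[ E ]) ⟨
        (concat (map [_] E) ++ concat Us) ++ V     ≡⟨ cong (_++ V) (concat-++ (map [_] E) Us) ⟩
        concat (map [_] E ++ Us) ++ V              ↭⟨ ++⁺ʳ V p′ ⟩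
        (concat Vs ++ R′) ++ V                     ≡⟨ ++-assoc (concat Vs) R′ V ⟩
        concat Vs ++ R′ ++ V                       ∎)
    where open PermutationReasoning

-- Linear maps over the field of two elements, and quotients killing given vectors.

replicate-++ : ∀ {A : Set} m {n} {x : A} → Vec.replicate (m + n) x ≡ Vec.replicate m x Vec.++ Vec.replicate n x
replicate-++ zero    = refl
replicate-++ (suc m) = cong (_ ∷_) (replicate-++ m)

⟨_,_⟩ : ∀ {G m n} → G ⟶ C₂^ m → G ⟶ C₂^ n → G ⟶ C₂^ (m + n)
⟨_,_⟩ {m = m} f g = record
  { ⟦_⟧    = λ x → ⟦ f ⟧ x Vec.++ ⟦ g ⟧ x
  ; ε-homo = ≡.trans (cong₂ Vec._++_ (ε-homo f) (ε-homo g)) (sym (replicate-++ m))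
  ; ∙-homo = λ x y → ≡.trans (cong₂ Vec._++_ (∙-homo f x y) (∙-homo g x y))
                             (sym (Vec.zipWith-++ _xor_ (⟦ f ⟧ x) (⟦ g ⟧ x) (⟦ f ⟧ y) (⟦ g ⟧ y)))
  }

head⟶ : ∀ {n} → C₂^ suc n ⟶ C₂^ 1
head⟶ = record
  { ⟦_⟧    = λ { (x ∷ _) → x ∷ [] }
  ; ε-homo = refl
  ; ∙-homo = λ { (_ ∷ _) (_ ∷ _) → refl }
  }

tail⟶ : ∀ {n} → C₂^ suc n ⟶ C₂^ n
tail⟶ = record
  { ⟦_⟧    = Vec.tail
  ; ε-homo = refl
  ; ∙-homo = λ { (_ ∷ _) (_ ∷ _) → refl }
  }

trivial⟶ : ∀ {G} → G ⟶ C₂^ 0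
trivial⟶ = record { ⟦_⟧ = λ _ → [] ; ε-homo = refl ; ∙-homo = λ _ _ → refl }

-- Gaussian elimination with pivot `true ∷ e`: adding `x` times the pivot clears the first
-- coordinate, which is then dropped.
eliminateFirst : ∀ {n} → Vec Bool n → C₂^ suc n ⟶ C₂^ n
eliminateFirst {n} e = record
  { ⟦_⟧    = λ { (x ∷ xs) → xs ⊕ Vec.map (x ∧_) e }
  ; ε-homo = ≡.trans (FiniteAbelianGroup.identityˡ (C₂^ n) _) (Vec.map-const e false)
  ; ∙-homo = λ { (x ∷ xs) (y ∷ ys) → homo x y xs ys e }
  }
  where
  open CommutativeSemigroupProperties (CommutativeRing.+-commutativeSemigroup xor-∧-commutativeRing)
    using (interchange)

  _⊕_ : ∀ {n} → Vec Bool n → Vec Bool n → Vec Bool n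
  _⊕_ = Vec.zipWith _xor_

  homo : ∀ {n} x y (xs ys e : Vec Bool n) →
         (xs ⊕ ys) ⊕ Vec.map ((x xor y) ∧_) e ≡ (xs ⊕ Vec.map (x ∧_) e) ⊕ (ys ⊕ Vec.map (y ∧_) e)
  homo x y []       []       []      = refl
  homo x y (a ∷ xs) (b ∷ ys) (c ∷ e) = cong₂ _∷_
    (≡.trans (cong ((a xor b) xor_) (∧-distribʳ-xor c x y)) (interchange a b (x ∧ c) (y ∧ c)))
    (homo x y xs ys e)

-- When e ≠ 0, this is the quotient by ⟨e⟩, eliminating the first coordinate at
-- which e does not vanish; when e = 0, it drops the last coordinate.
killVector : ∀ {n} (e : Vec Bool (suc n)) → ∃ λ (emb : Embedding (C₂^ suc n) (C₂^ n) (C₂^ 1)) →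
             ⟦ Embedding.π emb ⟧ e ≡ FiniteAbelianGroup.ε (C₂^ n)
killVector {n} (true ∷ e) =
  record { π = eliminateFirst e ; ψ = head⟶ ; kernel = kernel } , inverseʳ e
  where
  open FiniteAbelianGroup (C₂^ n) using (_∙_; ε; identityʳ; inverseʳ)
  kernel : ∀ x → ⟦ eliminateFirst e ⟧ x ≡ ε → ⟦ head⟶ {n} ⟧ x ≡ false ∷ [] → x ≡ false ∷ ε
  kernel (false ∷ xs) eq refl = cong (false ∷_)
    (≡.trans (sym (≡.trans (cong (xs ∙_) (Vec.map-const e false)) (identityʳ xs))) eq)
killVector {zero}  (false ∷ []) = record
  { π = tail⟶ ; ψ = head⟶ ; kernel = λ { (_ ∷ []) _ eq → eq } } , refl
killVector {suc n} (false ∷ e)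
  with emb , πe ← killVector e = record
  { π      = ⟨ head⟶ , Embedding.π emb ∘⟶ tail⟶ ⟩
  ; ψ      = Embedding.ψ emb ∘⟶ tail⟶
  ; kernel = λ { (x ∷ xs) eq ψ≡ → let x≡ , π≡ = Vec.∷-injective eq in
      cong₂ _∷_ x≡ (Embedding.kernel emb xs π≡ ψ≡) }
  } , cong (false ∷_) πe

-- After `e` is killed, the images of the other terms are killed in the quotient. Each term costs
-- exactly one coordinate, even when the terms are dependent, so the ranks are `r ∸ s` and `s`.
killVectors : ∀ {r} s (E : List (Vec Bool r)) → length E ≡ s → s ≤ r →
  ∃ λ (emb : Embedding (C₂^ r) (C₂^ (r ∸ s)) (C₂^ s)) →
  All (λ x → ⟦ Embedding.π emb ⟧ x ≡ FiniteAbelianGroup.ε (C₂^ (r ∸ s))) E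
killVectors zero [] refl _ =
  record { π = id⟶ ; ψ = trivial⟶ ; kernel = λ _ eq _ → eq } , []
killVectors (suc s) (e ∷ E) refl (s≤s s≤r)
  with emb₁ , πe ← killVector e
  with emb₂ , πE ← killVectors s (map ⟦ Embedding.π emb₁ ⟧ E) (length-map _ E) s≤r = record
  { π      = E₂.π ∘⟶ E₁.π
  ; ψ      = ⟨ E₁.ψ , E₂.ψ ∘⟶ E₁.π ⟩
  -- The first coordinate of `ψ≡` belongs to `E₁.ψ`. The others give that `⟦ E₁.π ⟧ x` vanishes, and
  -- then so does `x`.
  ; kernel = λ x π≡ ψ≡ → let ψ₁≡ , ψ₂≡ = Vec.++-injective (⟦ E₁.ψ ⟧ x) (false ∷ []) ψ≡ in
      E₁.kernel x (E₂.kernel (⟦ E₁.π ⟧ x) π≡ ψ₂≡) ψ₁≡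
  } , ≡.trans (cong ⟦ E₂.π ⟧ πe) (ε-homo E₂.π) ∷ All.map⁻ πE
  where
  module E₁ = Embedding emb₁
  module E₂ = Embedding emb₂

theorem7p15 : ∀ (k r s : ℕ) → 1 ≤ k → 1 ≤ r → s ≤ r →
    D k (C₂^ r) ≤ D (D k (C₂^ s) ∸ s) (C₂^ (r ∸ s)) + s
theorem7p15 k r s _ _ s≤r = proj₂ (D-isLeast k (C₂^ r)) (ℓ + s) forces
  where
  m ℓ : ℕ
  m = D k (C₂^ s) ∸ s
  ℓ = D m (C₂^ (r ∸ s))

  -- This suffices by minimality of `D k (C₂^ r)`. The first `s` terms of `S` serve as `E`.
  forces : Forces (C₂^ r) k (ℓ + s)
  forces S ℓ+s≤ =
    let |take|   = ≡.trans (length-take s S) (m≤n⇒m⊓n≡m (≤-trans (m≤n+m s ℓ) ℓ+s≤))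
        emb , πE = killVectors s (take s S) |take| s≤r
    in subst (HasDisjointZeroSums (C₂^ r) k) (take++drop≡id s S)
      (hasDisjointZeroSums-++ emb {n = D k (C₂^ s)} (take s S) (drop s S)
        (proj₁ (D-isLeast m (C₂^ (r ∸ s)))) (proj₁ (D-isLeast k (C₂^ s)))
        -- With `n = D k (C₂^ s)`, the bound `n ≤ s + (n ∸ s)` is valid for truncated subtraction.
        (≤-trans (m≤n+m∸n _ s) (≤-reflexive (cong (_+ m) (sym |take|)))) πE
        (≤-trans (≤-reflexive (sym (m+n∸n≡m ℓ s)))
          (≤-trans (∸-monoˡ-≤ s ℓ+s≤) (≤-reflexive (sym (length-drop s S))))))
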